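{- Let $m\ge4$. Let $A$ be the $m\times m$ coloring matrix whose rows $1$ and $2$ are zero, whose rows $3,4,\dots,m-1$ each have a single $1$ in column $2$ and zeros elsewhere, and whose row $m$ has ones in columns $1$ and $2$ and zeros elsewhere. Let $B$ be the $m\times m$ coloring matrix whose row $1$ is zero, whose rows $2$ and $3$ each have a single $1$ in column $m$ and zeros elsewhere, and whose rows $4,\dots,m$ each have a single $1$ in column $1$ and zeros elsewhere. Then for all $n\ge2$, $t_A(n)=t_B(n)=2^{n-1}+m-3$ (and $t_A(1)=t_B(1)=m$). However, $A$ and $B$ are not strongly tree coloring equivalent.
   Context: A plane tree is an unlabeled rooted tree in which the children of every vertex are linearly ordered. A coloring matrix is an $m\times m$ matrix $A=(a_{ij})$ with entries in $\{0,1\}$. An $A$-coloring of a plane tree assigns to each vertex a color in $\{1,\dots,m\}$ such that whenever a vertex of color $j$ is a child of a vertex of color $i$, $a_{ij}=1$. Let $t_A(n)$ be the number of pairs (plane tree with $n$ vertices, $A$-coloring of it) and $t_A^{(i)}(n)$ the number of those with root color $i$. Two $m\times m$ coloring matrices $A,B$ are strictly tree coloring equivalent if $t_A^{(i)}(n)=t_B^{(i)}(n)$ for all $n\ge1$ and all $i$; they are strongly tree coloring equivalent if there is an $m\times m$ permutation matrix $P$ such that $P^TAP$ and $B$ are strictly tree coloring equivalent. -}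

module Defs where

open import Axiom.UniquenessOfIdentityProofs using (module Decidable⇒UIP)
open import Data.Bool.Base using (Bool; true; false; _∧_; _∨_; if_then_else_)
open import Data.Empty using (⊥-elim)
open import Data.Fin.Base using (Fin; zero; suc; toℕ)
open import Data.Fin.Permutation using (Permutation′; _⟨$⟩ʳ_; _⟨$⟩ˡ_; inverseˡ; inverseʳ)
open import Data.Fin.Properties using (0↔⊥; 1↔⊤; +↔⊎; *↔×)
import Data.Fin.Properties as Fin
open import Data.List.Base using (List; []; _∷_)
open import Data.List.Relation.Unary.All using (All; []; _∷_)
open import Data.Nat.Base using (ℕ; zero; suc; _+_; _*_; _≤_; _≡ᵇ_; _≤ᵇ_; _<ᵇ_; z≤n; s≤s; s≤s⁻¹)
open import Data.Nat.Properties using (+-0-monoid; *-identityʳ; *-identityˡ; *-zeroʳ; +-identityʳ; ≤-trans; ≤-reflexive; ≤-irrelevant; m≤m+n; m≤n+m; n≤1+n; _≟_; _≤?_; ≡-irrelevant)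
open import Algebra.Properties.Monoid.Sum +-0-monoid using (sum-syntax)
open import Data.Product.Base using (Σ; Σ-syntax; ∃-syntax; _×_; _,_; proj₁; proj₂)
open import Data.Product.Function.Dependent.Propositional using (Σ-↔)
open import Data.Product.Function.NonDependent.Propositional using (_×-↔_)
open import Data.Sum.Base using (_⊎_; inj₁; inj₂)
open import Data.Sum.Function.Propositional using (_⊎-↔_)
open import Data.Unit.Base using (⊤; tt)
open import Function.Base using (_∘_)
open import Function.Bundles using (_↔_; mk↔ₛ′; Inverse)
open import Function.Properties.Inverse using (↔-refl; ↔-sym; ↔-trans)
open import Relation.Binary.PropositionalEquality using (_≡_; _≢_; refl; sym; trans; cong; cong₂; subst)
open import Relation.Nullary using (Dec; yes; no; does; Irrelevant)
open import Relation.Nullary.Decidable using (_×-dec_)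

record Finite (X : Set) : Set where
  constructor finite
  field
    card     : ℕ
    counting : Fin card ↔ X

open Finite public

finite-↔ : ∀ {X Y} → X ↔ Y → Finite X → Finite Y
finite-↔ e (finite k f) = finite k (↔-trans f e)

finite-⊤ : Finite ⊤
finite-⊤ = finite 1 1↔⊤

finite-⊎ : ∀ {X Y} → Finite X → Finite Y → Finite (X ⊎ Y)
finite-⊎ (finite k f) (finite l g) = finite (k + l) (↔-trans +↔⊎ (f ⊎-↔ g))

finite-× : ∀ {X Y} → Finite X → Finite Y → Finite (X × Y)
finite-× (finite k f) (finite l g) = finite (k * l) (↔-trans *↔× (f ×-↔ g))

finite-ΣFin : ∀ k {Y : Fin k → Set} → (∀ i → Finite (Y i)) → Finite (Σ (Fin k) Y)
finite-ΣFin zero    fin = finite 0 (mk↔ₛ′ (λ ()) (λ ()) (λ ()) (λ ()))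
finite-ΣFin (suc k) fin = finite-↔
  (mk↔ₛ′ (λ { (inj₁ y) → zero , y ; (inj₂ (i , y)) → suc i , y })
         (λ { (zero , y) → inj₁ y ; (suc i , y) → inj₂ (i , y) })
         (λ { (zero , y) → refl ; (suc i , y) → refl })
         (λ { (inj₁ y) → refl ; (inj₂ (i , y)) → refl }))
  (finite-⊎ (fin zero) (finite-ΣFin k (fin ∘ suc)))

finite-Σ : ∀ {X} {Y : X → Set} → Finite X → (∀ x → Finite (Y x)) → Finite (Σ X Y)
finite-Σ (finite k f) fin =
  finite-↔ (Σ-↔ f ↔-refl) (finite-ΣFin k (fin ∘ Inverse.to f))

finite-Dec : ∀ {P} → Irrelevant P → Dec P → Finite P
finite-Dec irr (yes p) = finite 1 (↔-trans 1↔⊤ (mk↔ₛ′ (λ _ → p) (λ _ → tt) (irr p) (λ _ → refl)))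
finite-Dec irr (no ¬p) = finite 0 (↔-trans 0↔⊥ (mk↔ₛ′ ⊥-elim ¬p (⊥-elim ∘ ¬p) (λ ())))

data PlaneTree : Set where
  node : List PlaneTree → PlaneTree

size  : PlaneTree → ℕ
sizes : List PlaneTree → ℕ

size (node ts) = suc (sizes ts)

sizes []       = 0
sizes (t ∷ ts) = size t + sizes ts

PlaneTreeOfSize : ℕ → Set
PlaneTreeOfSize n = Σ[ t ∈ PlaneTree ] size t ≡ n

ForestUpTo : ℕ → Set
ForestUpTo k = Σ[ ts ∈ List PlaneTree ] sizes ts ≤ k

Σ-irr : ∀ {X : Set} {P : X → Set} → (∀ {x} → Irrelevant (P x)) →
        {x y : X} {p : P x} {q : P y} → x ≡ y → (x , p) ≡ (y , q)
Σ-irr irr {x} {p = p} {q} refl = cong (x ,_) (irr p q)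

finite-forests : ∀ k → Finite (ForestUpTo k)
finite-forests zero = finite-↔
  (mk↔ₛ′ (λ _ → [] , z≤n) (λ _ → tt)
         (λ { ([] , p) → Σ-irr ≤-irrelevant refl ; (node _ ∷ _ , ()) })
         (λ _ → refl))
  finite-⊤
finite-forests (suc k) = finite-↔ (mk↔ₛ′ to from to∘from from∘to)
  (finite-⊎ finite-⊤
    (finite-Σ (finite-× (finite-forests k) (finite-forests k))
              (λ x → finite-Dec ≤-irrelevant (_ ≤? k))))
  where
  Split : Set
  Split = Σ[ x ∈ ForestUpTo k × ForestUpTo k ] sizes (proj₁ (proj₁ x)) + sizes (proj₁ (proj₂ x)) ≤ k

  to : ⊤ ⊎ Split → ForestUpTo (suc k)
  to (inj₁ _)                           = [] , z≤n
  to (inj₂ (((ts , _) , (us , _)) , p)) = node ts ∷ us , s≤s p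

  from : ForestUpTo (suc k) → ⊤ ⊎ Split
  from ([] , _)           = inj₁ tt
  from (node ts ∷ us , p) = inj₂
    (((ts , ≤-trans (m≤m+n _ _) (s≤s⁻¹ p)) , (us , ≤-trans (m≤n+m _ (sizes ts)) (s≤s⁻¹ p))) , s≤s⁻¹ p)

  to∘from : ∀ x → to (from x) ≡ x
  to∘from ([] , p)           = Σ-irr ≤-irrelevant refl
  to∘from (node ts ∷ us , p) = Σ-irr ≤-irrelevant refl

  from∘to : ∀ x → from (to x) ≡ x
  from∘to (inj₁ _) = refl
  from∘to (inj₂ (((ts , _) , (us , _)) , p)) =
    cong inj₂ (Σ-irr ≤-irrelevant
      (cong₂ _,_ (Σ-irr ≤-irrelevant refl) (Σ-irr ≤-irrelevant refl)))

finite-trees : ∀ n → Finite (PlaneTreeOfSize n)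
finite-trees n = finite-↔
  (mk↔ₛ′ (λ { ((ts , _) , p) → node ts , p })
         (λ { (node ts , p) → (ts , ≤-trans (n≤1+n _) (≤-reflexive p)) , p })
         (λ { (node ts , p) → refl })
         (λ { ((ts , _) , p) → Σ-irr ≡-irrelevant (Σ-irr ≤-irrelevant refl) }))
  (finite-Σ (finite-forests n) (λ x → finite-Dec ≡-irrelevant (_ ≟ n)))

Matrix : ℕ → Set
Matrix m = Fin m → Fin m → ℕ

infixl 7 _⊗_
infix  8 _ᵀ

_⊗_ : ∀ {m} → Matrix m → Matrix m → Matrix m
_⊗_ {m} M N i j = ∑[ k < m ] (M i k * N k j)

_ᵀ : ∀ {m} → Matrix m → Matrix m
(M ᵀ) i j = M j i

indicator : Bool → ℕ
indicator b = if b then 1 else 0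

permutationMatrix : ∀ {m} → Permutation′ m → Matrix m
permutationMatrix π i j = indicator (does ((π ⟨$⟩ʳ i) Fin.≟ j))

record ColoringMatrix (m : ℕ) : Set where
  constructor coloringMatrix
  field
    entry  : Matrix m
    binary : ∀ i j → entry i j ≡ 0 ⊎ entry i j ≡ 1

open ColoringMatrix public

sum-zero : ∀ {m} (f : Fin m → ℕ) → (∀ k → f k ≡ 0) → ∑[ k < m ] f k ≡ 0
sum-zero {zero}  f f≡0 = refl
sum-zero {suc m} f f≡0 = cong₂ _+_ (f≡0 zero) (sum-zero (f ∘ suc) (f≡0 ∘ suc))

sum-single : ∀ {m} (f : Fin m → ℕ) c → (∀ k → k ≢ c → f k ≡ 0) → ∑[ k < m ] f k ≡ f c
sum-single f zero off =
  trans (cong (f zero +_) (sum-zero (f ∘ suc) (λ k → off (suc k) λ ()))) (+-identityʳ _)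
sum-single f (suc c) off =
  cong₂ _+_ (off zero λ ()) (sum-single (f ∘ suc) c (λ k k≢c → off (suc k) (k≢c ∘ Fin.suc-injective)))

permutationMatrix-on : ∀ {m} (π : Permutation′ m) j → permutationMatrix π (π ⟨$⟩ˡ j) j ≡ 1
permutationMatrix-on π j with (π ⟨$⟩ʳ (π ⟨$⟩ˡ j)) Fin.≟ j
... | yes _ = refl
... | no ¬p = ⊥-elim (¬p (inverseʳ π))

permutationMatrix-off : ∀ {m} (π : Permutation′ m) j k → k ≢ π ⟨$⟩ˡ j → permutationMatrix π k j ≡ 0
permutationMatrix-off π j k k≢ with (π ⟨$⟩ʳ k) Fin.≟ j
... | yes refl = ⊥-elim (k≢ (sym (inverseˡ π)))
... | no _     = refl

conjugate-entry : ∀ {m} (π : Permutation′ m) (M : Matrix m) i j →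
  (permutationMatrix π ᵀ ⊗ M ⊗ permutationMatrix π) i j ≡ M (π ⟨$⟩ˡ i) (π ⟨$⟩ˡ j)
conjugate-entry {m} π M i j = trans
  (sum-single (λ l → Q l * P l j) j′ (λ l l≢ →
    trans (cong (Q l *_) (permutationMatrix-off π j l l≢)) (*-zeroʳ (Q l))))
  (trans (cong (Q j′ *_) (permutationMatrix-on π j))
  (trans (*-identityʳ (Q j′))
  (trans (sum-single (λ k → P k i * M k j′) i′ (λ k k≢ →
    cong (_* M k j′) (permutationMatrix-off π i k k≢)))
  (trans (cong (_* M i′ j′) (permutationMatrix-on π i)) (*-identityˡ (M i′ j′))))))
  where
  P : Matrix m
  P = permutationMatrix π
  i′ j′ : Fin m
  i′ = π ⟨$⟩ˡ i
  j′ = π ⟨$⟩ˡ j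
  Q : Fin m → ℕ
  Q l = (P ᵀ ⊗ M) i l

-- PᵀAP for the permutation matrix P of π.
conjugate : ∀ {m} → Permutation′ m → ColoringMatrix m → ColoringMatrix m
conjugate π A .entry = permutationMatrix π ᵀ ⊗ A .entry ⊗ permutationMatrix π
conjugate π A .binary i j =
  subst (λ x → x ≡ 0 ⊎ x ≡ 1) (sym (conjugate-entry π (A .entry) i j)) (A .binary _ _)

-- A map from the vertices of the indexing tree to colors, as a decoration of
-- the tree rather than a function, so that _≡_ is the right equality.
data VertexColors (m : ℕ) : PlaneTree → Set where
  node : ∀ {ts} → Fin m → All (VertexColors m) ts → VertexColors m (node ts)

rootColor : ∀ {m t} → VertexColors m t → Fin m
rootColor (node i _) = i

mutual
  Admissible : ∀ {m} → ColoringMatrix m → ∀ {t} → VertexColors m t → Set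
  Admissible A (node i cs) = AdmissibleChildren A i cs

  AdmissibleChildren : ∀ {m} → ColoringMatrix m → Fin m → ∀ {ts} → All (VertexColors m) ts → Set
  AdmissibleChildren A i []       = ⊤
  AdmissibleChildren A i (c ∷ cs) =
    (entry A i (rootColor c) ≡ 1 × Admissible A c) × AdmissibleChildren A i cs

Coloring : ∀ {m} → ColoringMatrix m → PlaneTree → Set
Coloring {m} A t = Σ[ c ∈ VertexColors m t ] Admissible A c

ColoredTree : ∀ {m} → ColoringMatrix m → ℕ → Set
ColoredTree A n = Σ[ t ∈ PlaneTreeOfSize n ] Coloring A (proj₁ t)

treeRootColor : ∀ {m} {A : ColoringMatrix m} {n} → ColoredTree A n → Fin m
treeRootColor (_ , c , _) = rootColor c

ColoredTreeWithRoot : ∀ {m} → ColoringMatrix m → Fin m → ℕ → Set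
ColoredTreeWithRoot A i n = Σ[ x ∈ ColoredTree A n ] treeRootColor {A = A} x ≡ i

mutual
  finite-VertexColors : ∀ m t → Finite (VertexColors m t)
  finite-VertexColors m (node ts) = finite-↔
    (mk↔ₛ′ (λ { (i , cs) → node i cs }) (λ { (node i cs) → i , cs })
           (λ { (node i cs) → refl }) (λ _ → refl))
    (finite-× (finite m ↔-refl) (finite-AllVertexColors m ts))

  finite-AllVertexColors : ∀ m ts → Finite (All (VertexColors m) ts)
  finite-AllVertexColors m [] = finite-↔
    (mk↔ₛ′ (λ _ → []) (λ _ → tt) (λ { [] → refl }) (λ _ → refl)) finite-⊤
  finite-AllVertexColors m (t ∷ ts) = finite-↔
    (mk↔ₛ′ (λ { (c , cs) → c ∷ cs }) (λ { (c ∷ cs) → c , cs })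
           (λ { (c ∷ cs) → refl }) (λ _ → refl))
    (finite-× (finite-VertexColors m t) (finite-AllVertexColors m ts))

mutual
  finite-Admissible : ∀ {m} (A : ColoringMatrix m) {t} (c : VertexColors m t) → Finite (Admissible A c)
  finite-Admissible A (node i cs) = finite-AdmissibleChildren A i cs

  finite-AdmissibleChildren : ∀ {m} (A : ColoringMatrix m) i {ts} (cs : All (VertexColors m) ts) →
                              Finite (AdmissibleChildren A i cs)
  finite-AdmissibleChildren A i []       = finite-⊤
  finite-AdmissibleChildren A i (c ∷ cs) = finite-×
    (finite-× (finite-Dec ≡-irrelevant (_ ≟ 1)) (finite-Admissible A c))
    (finite-AdmissibleChildren A i cs)

-- Admissibility is a proposition, so counting ColoredTree counts each pair
-- (tree, coloring) exactly once.
mutual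
  Admissible-irrelevant : ∀ {m} (A : ColoringMatrix m) {t} (c : VertexColors m t) → Irrelevant (Admissible A c)
  Admissible-irrelevant A (node i cs) = AdmissibleChildren-irrelevant A i cs

  AdmissibleChildren-irrelevant : ∀ {m} (A : ColoringMatrix m) i {ts} (cs : All (VertexColors m) ts) →
                                  Irrelevant (AdmissibleChildren A i cs)
  AdmissibleChildren-irrelevant A i []       _ _ = refl
  AdmissibleChildren-irrelevant A i (c ∷ cs) ((p , q) , r) ((p′ , q′) , r′) =
    cong₂ _,_ (cong₂ _,_ (≡-irrelevant p p′) (Admissible-irrelevant A c q q′))
              (AdmissibleChildren-irrelevant A i cs r r′)

finite-ColoredTree : ∀ {m} (A : ColoringMatrix m) n → Finite (ColoredTree A n)
finite-ColoredTree {m} A n = finite-Σ (finite-trees n) λ t →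
  finite-Σ (finite-VertexColors m (proj₁ t)) (finite-Admissible A)

finite-ColoredTreeWithRoot : ∀ {m} (A : ColoringMatrix m) i n → Finite (ColoredTreeWithRoot A i n)
finite-ColoredTreeWithRoot A i n = finite-Σ (finite-ColoredTree A n) λ x →
  finite-Dec (Decidable⇒UIP.≡-irrelevant Fin._≟_) (_ Fin.≟ i)

-- t_A(n); the witness counting (finite-ColoredTree A n) is a bijection
-- Fin (treeCount A n) ↔ ColoredTree A n.
treeCount : ∀ {m} → ColoringMatrix m → ℕ → ℕ
treeCount A n = card (finite-ColoredTree A n)

-- t_A^{(i)}(n).
treeCountWithRoot : ∀ {m} → ColoringMatrix m → Fin m → ℕ → ℕ
treeCountWithRoot A i n = card (finite-ColoredTreeWithRoot A i n)

StrictlyTreeColoringEquivalent : ∀ {m} → ColoringMatrix m → ColoringMatrix m → Set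
StrictlyTreeColoringEquivalent A B =
  ∀ n → 1 ≤ n → ∀ i → treeCountWithRoot A i n ≡ treeCountWithRoot B i n

StronglyTreeColoringEquivalent : ∀ {m} → ColoringMatrix m → ColoringMatrix m → Set
StronglyTreeColoringEquivalent {m} A B =
  ∃[ π ] StrictlyTreeColoringEquivalent (conjugate {m} π A) B

indicator-binary : ∀ b → indicator b ≡ 0 ⊎ indicator b ≡ 1
indicator-binary false = inj₁ refl
indicator-binary true  = inj₂ refl

-- The m × m coloring matrix with 1 exactly where f holds, where f receives
-- the row and column numbers counted from 1.
fromPositions : ∀ m → (ℕ → ℕ → Bool) → ColoringMatrix m
fromPositions m f .entry  i j = indicator (f (suc (toℕ i)) (suc (toℕ j)))
fromPositions m f .binary i j = indicator-binary (f (suc (toℕ i)) (suc (toℕ j)))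

matrixA : ∀ m → ColoringMatrix m
matrixA m = fromPositions m λ r c →
    ((3 ≤ᵇ r) ∧ (r <ᵇ m) ∧ (c ≡ᵇ 2))
  ∨ ((r ≡ᵇ m) ∧ ((c ≡ᵇ 1) ∨ (c ≡ᵇ 2)))

matrixB : ∀ m → ColoringMatrix m
matrixB m = fromPositions m λ r c →
    (((r ≡ᵇ 2) ∨ (r ≡ᵇ 3)) ∧ (c ≡ᵇ m))
  ∨ ((4 ≤ᵇ r) ∧ (c ≡ᵇ 1))

{-# OPTIONS --safe #-}

-- Cutting off the root turns a colored tree with root color i into a forest
-- whose roots have colors allowed below i. If every color allowed below i is
-- itself childless, such a forest is a word over the allowed colors, so there
-- are sᵏ of them of size k, where s is the number of allowed colors. In A every
-- row is of this kind, with s = 0, 0, 1, …, 1, 2. In B this holds for s = 0 in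
-- row 1 and s = 1 in rows 4, …, m, while the forests of size k + 1 below color 2
-- or 3 correspond to compositions of k + 1, of which there are 2ᵏ.
-- Strong equivalence fails already at n = 2: two colors of A are the root of no
-- tree with two vertices, but only one color of B is.
module Submission where

open import Defs
open import Data.Bool.Base using (true; false)
open import Data.Empty using (⊥-elim)
open import Data.Fin.Base using (Fin; zero; suc; toℕ; inject₁; fromℕ)
open import Data.Fin.Permutation using (↔⇒≡; _⟨$⟩ʳ_; _⟨$⟩ˡ_; inverseˡ)
open import Data.Fin.Properties using (0↔⊥; 0≢1+n)
open import Data.List.Base using (List; []; _∷_)
open import Data.List.Relation.Unary.All using (All; []; _∷_)
open import Data.Nat.Base using (ℕ; zero; suc; _+_; _*_; _∸_; _^_; _≤_; _≡ᵇ_; _<ᵇ_; z≤n; s≤s)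
open import Data.Nat.Properties using (+-0-monoid; +-assoc; +-comm; +-identityʳ; ^-zeroˡ; ≡-irrelevant; suc-injective; 1+n≢0)
open import Algebra.Properties.Monoid.Sum +-0-monoid using (sum-syntax; sum-init-last)
open import Data.Product.Base using (Σ-syntax; _×_; _,_; proj₁; proj₂)
open import Data.Sum.Base using (_⊎_; inj₁; inj₂)
open import Data.Unit.Base using (⊤; tt)
open import Function.Base using (_∘_)
open import Function.Bundles using (_↔_; mk↔ₛ′)
open import Function.Properties.Inverse using (↔-sym; ↔-trans)
open import Relation.Binary.PropositionalEquality using (_≡_; refl; sym; trans; cong; cong₂; subst; module ≡-Reasoning)
open import Relation.Nullary using (¬_)

-- Cardinalities, finite sums, and counting by root color.

card-unique : ∀ {X Y} (F : Finite X) (G : Finite Y) → X ↔ Y → card F ≡ card G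
card-unique F G e = ↔⇒≡ (↔-trans (counting F) (↔-trans e (↔-sym (counting G))))

card-finite-ΣFin : ∀ k {Y : Fin k → Set} (fin : ∀ i → Finite (Y i)) →
                   card (finite-ΣFin k fin) ≡ ∑[ i < k ] card (fin i)
card-finite-ΣFin zero    fin = refl
card-finite-ΣFin (suc k) fin = cong (card (fin zero) +_) (card-finite-ΣFin k (fin ∘ suc))

sum-one : ∀ n (f : Fin n → ℕ) → (∀ i → f i ≡ 1) → ∑[ i < n ] f i ≡ n
sum-one zero    f f≡1 = refl
sum-one (suc n) f f≡1 = cong₂ _+_ (f≡1 zero) (sum-one n (f ∘ suc) (f≡1 ∘ suc))

-- Copies of the counting functions that do not unfold: comparing instances of
-- the originals by evaluation is infeasible.
abstract

  #trees : ∀ {m} → ColoringMatrix m → ℕ → ℕ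
  #trees = treeCount

  #treesWithRoot : ∀ {m} → ColoringMatrix m → Fin m → ℕ → ℕ
  #treesWithRoot = treeCountWithRoot

  treeCount≡#trees : ∀ {m} (A : ColoringMatrix m) n → treeCount A n ≡ #trees A n
  treeCount≡#trees A n = refl

  #treesWithRoot-equivalent : ∀ {m} {A B : ColoringMatrix m} → StrictlyTreeColoringEquivalent A B →
                              ∀ n → 1 ≤ n → ∀ i → #treesWithRoot A i n ≡ #treesWithRoot B i n
  #treesWithRoot-equivalent equivalent = equivalent

  #trees-sum : ∀ {m} (A : ColoringMatrix m) n → #trees A n ≡ ∑[ i < m ] #treesWithRoot A i n
  #trees-sum {m} A n = trans
    (card-unique (finite-ColoredTree A n) (finite-ΣFin m λ i → finite-ColoredTreeWithRoot A i n)
      (mk↔ₛ′ (λ x → treeRootColor {A = A} x , x , refl) (λ (_ , x , _) → x)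
             (λ { (_ , _ , refl) → refl }) (λ _ → refl)))
    (card-finite-ΣFin m λ i → finite-ColoredTreeWithRoot A i n)

  #treesWithRoot-card : ∀ {m} (A : ColoringMatrix m) i n {Y} (F : Finite Y) →
                        ColoredTreeWithRoot A i n ↔ Y → #treesWithRoot A i n ≡ card F
  #treesWithRoot-card A i n = card-unique (finite-ColoredTreeWithRoot A i n)

-- Forests allowed below a color, and cutting off the root.

module _ {m} (A : ColoringMatrix m) where

  Child : Fin m → Set
  Child i = Σ[ j ∈ Fin m ] entry A i j ≡ 1

  -- grow c f g adds to g a first tree, with root color c and child forest f.
  data Forest (i : Fin m) : Set where
    []   : Forest i
    grow : (c : Child i) → Forest (proj₁ c) → Forest i → Forest i

  Childless : Fin m → Set
  Childless i = ¬ Child i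

  OnlyChild : Fin m → Fin m → Set
  OnlyChild i j = entry A i j ≡ 1 × (∀ k → entry A i k ≡ 1 → k ≡ j)

module _ {m} {A : ColoringMatrix m} where

  forestSize : ∀ {i} → Forest A i → ℕ
  forestSize []           = 0
  forestSize (grow _ f g) = suc (forestSize f + forestSize g)

  toForest : ∀ {i} ts (cs : All (VertexColors m) ts) → AdmissibleChildren A i cs → Forest A i
  toForest []             []               _             = []
  toForest (node ts ∷ us) (node j cs ∷ ds) ((e , p) , q) = grow (j , e) (toForest ts cs p) (toForest us ds q)

  shape : ∀ {i} → Forest A i → List PlaneTree
  shape []           = []
  shape (grow _ f g) = node (shape f) ∷ shape g

  colors : ∀ {i} (f : Forest A i) → All (VertexColors m) (shape f)
  colors []                 = []
  colors (grow (j , _) f g) = node j (colors f) ∷ colors g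

  colors-admissible : ∀ {i} (f : Forest A i) → AdmissibleChildren A i (colors f)
  colors-admissible []                 = tt
  colors-admissible (grow (_ , e) f g) = (e , colors-admissible f) , colors-admissible g

  sizes-shape : ∀ {i} (f : Forest A i) → sizes (shape f) ≡ forestSize f
  sizes-shape []           = refl
  sizes-shape (grow _ f g) = cong suc (cong₂ _+_ (sizes-shape f) (sizes-shape g))

  forestSize-toForest : ∀ {i} ts (cs : All (VertexColors m) ts) (p : AdmissibleChildren A i cs) →
                        forestSize (toForest ts cs p) ≡ sizes ts
  forestSize-toForest []             []               _             = refl
  forestSize-toForest (node ts ∷ us) (node j cs ∷ ds) ((_ , p) , q) =
    cong suc (cong₂ _+_ (forestSize-toForest ts cs p) (forestSize-toForest us ds q))

  toForest-colors : ∀ {i} (f : Forest A i) → toForest (shape f) (colors f) (colors-admissible f) ≡ f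
  toForest-colors []           = refl
  toForest-colors (grow c f g) = cong₂ (grow c) (toForest-colors f) (toForest-colors g)

  -- Shape, coloring and admissibility are packed together because the types of the last two depend
  -- on the shape; a round trip is then a single homogeneous equation.
  ColoredForest : Fin m → Set
  ColoredForest i = Σ[ ts ∈ List PlaneTree ] Σ[ cs ∈ All (VertexColors m) ts ] AdmissibleChildren A i cs

  -- The counterpart of `grow` on packed triples, which turns the induction step of
  -- `colors-toForest` into a congruence.
  plant : ∀ {i} → (c : Child A i) → ColoredForest (proj₁ c) → ColoredForest i → ColoredForest i
  plant (j , e) (ts , cs , p) (us , ds , q) = node ts ∷ us , node j cs ∷ ds , (e , p) , q

  colors-toForest : ∀ {i} ts (cs : All (VertexColors m) ts) (p : AdmissibleChildren A i cs) →
                    let f = toForest ts cs p in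
                    _≡_ {A = ColoredForest i} (shape f , colors f , colors-admissible f) (ts , cs , p)
  colors-toForest []             []               _             = refl
  colors-toForest (node ts ∷ us) (node j cs ∷ ds) ((e , p) , q) =
    cong₂ (plant (j , e)) (colors-toForest ts cs p) (colors-toForest us ds q)

module _ {m} (A : ColoringMatrix m) where

  ForestOfSize : Fin m → ℕ → Set
  ForestOfSize i k = Σ[ f ∈ Forest A i ] forestSize f ≡ k

  ColoredTreeWithRoot↔ForestOfSize : ∀ i k → ColoredTreeWithRoot A i (suc k) ↔ ForestOfSize i k
  ColoredTreeWithRoot↔ForestOfSize i k = mk↔ₛ′ to from to∘from from∘to
    where
    to : ColoredTreeWithRoot A i (suc k) → ForestOfSize i k
    to (((node ts , s) , node _ cs , p) , refl) =
      toForest ts cs p , trans (forestSize-toForest ts cs p) (suc-injective s)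

    toTree : (x : ColoredForest {A = A} i) → sizes (proj₁ x) ≡ k → ColoredTreeWithRoot A i (suc k)
    toTree (ts , cs , p) s = ((node ts , cong suc s) , node i cs , p) , refl

    from : ForestOfSize i k → ColoredTreeWithRoot A i (suc k)
    from (f , s) = toTree (shape f , colors f , colors-admissible f) (trans (sizes-shape f) s)

    to∘from : ∀ x → to (from x) ≡ x
    to∘from (f , _) = Σ-irr ≡-irrelevant (toForest-colors f)

    -- The size proofs may differ, since equality proofs in ℕ are irrelevant.
    toTree-cong : ∀ {x y} {s t} → x ≡ y → toTree x s ≡ toTree y t
    toTree-cong {x} refl = cong (toTree x) (≡-irrelevant _ _)

    from∘to : ∀ x → from (to x) ≡ x
    from∘to (((node ts , s) , node _ cs , p) , refl) = trans
      (toTree-cong {t = suc-injective s} (colors-toForest ts cs p))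
      (cong (λ s → ((node ts , s) , node i cs , p) , refl) (≡-irrelevant _ _))

  #treesWithRoot-forests : ∀ i k (F : Finite (ForestOfSize i k)) →
                           #treesWithRoot A i (suc k) ≡ card F
  #treesWithRoot-forests i k F =
    #treesWithRoot-card A i (suc k) F (ColoredTreeWithRoot↔ForestOfSize i k)

  -- Counting forests below a color with childless or path-like descendants.

  ⊤↔ForestOfSize-zero : ∀ i → ⊤ ↔ ForestOfSize i 0
  ⊤↔ForestOfSize-zero i =
    mk↔ₛ′ (λ _ → [] , refl) (λ _ → tt) (λ { ([] , refl) → refl ; (grow _ _ _ , ()) }) (λ _ → refl)

  ⊤↔Child : ∀ {i j} → OnlyChild A i j → ⊤ ↔ Child A i
  ⊤↔Child {j = j} (e , unique) =
    mk↔ₛ′ (λ _ → j , e) (λ _ → tt) (λ (k , e′) → Σ-irr ≡-irrelevant (sym (unique k e′))) (λ _ → refl)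

  Child-unique : ∀ {i j} → OnlyChild A i j → (c d : Child A i) → c ≡ d
  Child-unique (_ , unique) (k , e) (l , e′) =
    Σ-irr ≡-irrelevant (trans (unique k e) (sym (unique l e′)))

  module _ {i} (leaves : (c : Child A i) → Childless A (proj₁ c)) where

    -- The root of the first tree has a childless color, so that tree is a single vertex: peeling it
    -- off leaves a color and a forest with one vertex less.
    ForestOfSize-leaves : ∀ k → (Child A i × ForestOfSize i k) ↔ ForestOfSize i (suc k)
    ForestOfSize-leaves k = mk↔ₛ′
      (λ (c , g , s) → grow c [] g , cong suc s)
      (λ { (grow c [] g , s) → c , g , suc-injective s
         ; (grow c (grow d _ _) _ , _) → ⊥-elim (leaves c d) })
      (λ { (grow c [] g , s) → Σ-irr ≡-irrelevant refl
         ; (grow c (grow d _ _) _ , _) → ⊥-elim (leaves c d) })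
      (λ (c , g , s) → cong (c ,_) (Σ-irr ≡-irrelevant refl))

    finite-leaves : Finite (Child A i) → ∀ k → Finite (ForestOfSize i k)
    finite-leaves S zero    = finite-↔ (⊤↔ForestOfSize-zero i) finite-⊤
    finite-leaves S (suc k) = finite-↔ (ForestOfSize-leaves k) (finite-× S (finite-leaves S k))

    card-finite-leaves : ∀ S k → card (finite-leaves S k) ≡ card S ^ k
    card-finite-leaves S zero    = refl
    card-finite-leaves S (suc k) = cong (card S *_) (card-finite-leaves S k)

    #treesWithRoot-leaves : ∀ (S : Finite (Child A i)) k →
                            #treesWithRoot A i (suc k) ≡ card S ^ k
    #treesWithRoot-leaves S k =
      trans (#treesWithRoot-forests i k (finite-leaves S k)) (card-finite-leaves S k)

  module _ {i j l} (i→j : OnlyChild A i j) (j→l : OnlyChild A j l) (leaf : Childless A l) where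

    private
      -- A child `c` of `i` equals `j` only propositionally, so the facts about `j` and `l` are
      -- transported to an arbitrary `c`.
      grandchild : (c : Child A i) → OnlyChild A (proj₁ c) l
      grandchild (k , e) = subst (λ k → OnlyChild A k l) (sym (proj₂ i→j k e)) j→l

      leaves : (c : Child A i) (d : Child A (proj₁ c)) → Childless A (proj₁ d)
      leaves c (k , e) = subst (Childless A) (sym (proj₂ (grandchild c) k e)) leaf

      leafChild : (c : Child A i) → Child A (proj₁ c)
      leafChild c = l , proj₁ (grandchild c)

    -- Either the first tree is a single vertex, which is removed, or its first
    -- child is.
    ForestOfSize-path : ∀ k → (ForestOfSize i (suc k) ⊎ ForestOfSize i (suc k)) ↔ ForestOfSize i (suc (suc k))
    ForestOfSize-path k = mk↔ₛ′ to from to∘from from∘to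
      where
      to : ForestOfSize i (suc k) ⊎ ForestOfSize i (suc k) → ForestOfSize i (suc (suc k))
      to (inj₁ (g , s))          = grow (j , proj₁ i→j) [] g , cong suc s
      -- Positive size guarantees a first tree, which receives a leaf as its new first child.
      to (inj₂ (grow c f g , s)) = grow c (grow (leafChild c) [] f) g , cong suc s

      from : ForestOfSize i (suc (suc k)) → ForestOfSize i (suc k) ⊎ ForestOfSize i (suc k)
      from (grow c [] g , s)                      = inj₁ (g , suc-injective s)
      from (grow c (grow d [] f) g , s)           = inj₂ (grow c f g , suc-injective s)
      -- The color of `d` is `l`, which is childless, so there is no third level.
      from (grow c (grow d (grow e _ _) _) _ , _) = ⊥-elim (leaves c d e)

      to∘from : ∀ x → to (from x) ≡ x
      to∘from (grow c [] g , s) with refl ← Child-unique i→j c (j , proj₁ i→j) = Σ-irr ≡-irrelevant refl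
      to∘from (grow c (grow d [] f) g , s) with refl ← Child-unique (grandchild c) d (leafChild c) =
        Σ-irr ≡-irrelevant refl
      to∘from (grow c (grow d (grow e _ _) _) _ , _) = ⊥-elim (leaves c d e)

      from∘to : ∀ x → from (to x) ≡ x
      from∘to (inj₁ (g , s))          = cong inj₁ (Σ-irr ≡-irrelevant refl)
      from∘to (inj₂ (grow c f g , s)) = cong inj₂ (Σ-irr ≡-irrelevant refl)

    -- The doubling starts here and not at the empty forest: sizes zero and one both have exactly
    -- one forest.
    ⊤↔ForestOfSize-path-one : ⊤ ↔ ForestOfSize i 1
    ⊤↔ForestOfSize-path-one = mk↔ₛ′
      (λ _ → grow (j , proj₁ i→j) [] [] , refl) (λ _ → tt)
      (λ { ([] , ())
         ; (grow c [] [] , s) → Σ-irr ≡-irrelevant (cong (λ c → grow c [] []) (Child-unique i→j _ c))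
         ; (grow _ [] (grow _ _ _) , ())
         ; (grow _ (grow _ _ _) _ , ()) })
      (λ _ → refl)

    finite-path : ∀ k → Finite (ForestOfSize i (suc k))
    finite-path zero    = finite-↔ ⊤↔ForestOfSize-path-one finite-⊤
    finite-path (suc k) = finite-↔ (ForestOfSize-path k) (finite-⊎ (finite-path k) (finite-path k))

    card-finite-path : ∀ k → card (finite-path k) ≡ 2 ^ k
    card-finite-path zero    = refl
    card-finite-path (suc k) =
      cong₂ _+_ (card-finite-path k) (trans (card-finite-path k) (sym (+-identityʳ _)))

    #treesWithRoot-path : ∀ k → #treesWithRoot A i (suc (suc k)) ≡ 2 ^ k
    #treesWithRoot-path k =
      trans (#treesWithRoot-forests i (suc k) (finite-path k)) (card-finite-path k)

  #trees-one : #trees A 1 ≡ m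
  #trees-one = trans (#trees-sum A 1) (sum-one m (λ i → #treesWithRoot A i 1) λ i →
    #treesWithRoot-forests i 0 (finite-↔ (⊤↔ForestOfSize-zero i) finite-⊤))

  -- The case of no allowed colors, giving `0 ^ suc k`. Size one is excluded because a childless
  -- root alone is a tree.
  #treesWithRoot-childless : ∀ {i} → Childless A i → ∀ k → #treesWithRoot A i (suc (suc k)) ≡ 0
  #treesWithRoot-childless ¬c k = #treesWithRoot-leaves (λ c → ⊥-elim (¬c c))
    (finite 0 (↔-trans 0↔⊥ (mk↔ₛ′ ⊥-elim ¬c (λ c → ⊥-elim (¬c c)) (λ ())))) (suc k)

  #treesWithRoot-onlyLeaf : ∀ {i j} → OnlyChild A i j → Childless A j →
                            ∀ k → #treesWithRoot A i (suc k) ≡ 1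
  #treesWithRoot-onlyLeaf i→j leaf k = trans
    (#treesWithRoot-leaves
      (λ (c , e) → subst (Childless A) (sym (proj₂ i→j c e)) leaf)
      (finite-↔ (⊤↔Child i→j) finite-⊤) k)
    (^-zeroˡ k)

-- Boolean tests for the last index.

inject₁-<ᵇ : ∀ {n} (i : Fin n) → (toℕ (inject₁ i) <ᵇ n) ≡ true
inject₁-<ᵇ zero    = refl
inject₁-<ᵇ (suc i) = inject₁-<ᵇ i

inject₁-≡ᵇ : ∀ {n} (i : Fin n) → (toℕ (inject₁ i) ≡ᵇ n) ≡ false
inject₁-≡ᵇ zero    = refl
inject₁-≡ᵇ (suc i) = inject₁-≡ᵇ i

fromℕ-<ᵇ : ∀ n → (toℕ (fromℕ n) <ᵇ n) ≡ false
fromℕ-<ᵇ zero    = refl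
fromℕ-<ᵇ (suc n) = fromℕ-<ᵇ n

fromℕ-≡ᵇ : ∀ n → (toℕ (fromℕ n) ≡ᵇ n) ≡ true
fromℕ-≡ᵇ zero    = refl
fromℕ-≡ᵇ (suc n) = fromℕ-≡ᵇ n

≡ᵇ-fromℕ : ∀ {n} (i : Fin (suc n)) → (toℕ i ≡ᵇ n) ≡ true → i ≡ fromℕ n
≡ᵇ-fromℕ {zero}  zero    _ = refl
≡ᵇ-fromℕ {suc n} (suc i) p = cong suc (≡ᵇ-fromℕ i p)

module _ (l : ℕ) where

  private
    A B : ColoringMatrix (4 + l)
    A = matrixA (4 + l)
    B = matrixB (4 + l)

  -- The rows of A and its tree counts, with m = 4 + l.

  A-childless₁ : Childless A zero
  A-childless₁ (_ , ())

  A-childless₂ : Childless A (suc zero)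
  A-childless₂ (_ , ())

  -- Here `inject₁ i` runs through rows 3 to m - 1; the rewrites decide the tests that compare the
  -- row number with m.
  A-middle : (i : Fin (suc l)) → OnlyChild A (suc (suc (inject₁ i))) (suc zero)
  A-middle i rewrite inject₁-<ᵇ i | inject₁-≡ᵇ i =
    refl , λ { zero () ; (suc zero) _ → refl ; (suc (suc _)) () }

  A-last : Fin 2 ↔ Child A (suc (suc (fromℕ (suc l))))
  A-last rewrite fromℕ-<ᵇ l | fromℕ-≡ᵇ l = mk↔ₛ′
    (λ { zero → zero , refl ; (suc zero) → suc zero , refl })
    (λ { (zero , _) → zero ; (suc zero , _) → suc zero ; (suc (suc _) , ()) })
    (λ { (zero , refl) → refl ; (suc zero , refl) → refl ; (suc (suc _) , ()) })
    (λ { zero → refl ; (suc zero) → refl })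

  A-last-leaves : (c : Child A (suc (suc (fromℕ (suc l))))) → Childless A (proj₁ c)
  A-last-leaves (zero        , _) = A-childless₁
  A-last-leaves (suc zero    , _) = A-childless₂
  A-last-leaves (suc (suc _) , e) rewrite fromℕ-<ᵇ l | fromℕ-≡ᵇ l with () ← e

  #trees-A : ∀ k → #trees A (2 + k) ≡ 2 ^ (1 + k) + (1 + l)
  #trees-A k = begin
    #trees A (2 + k)
      ≡⟨ #trees-sum A (2 + k) ⟩
    t zero + (t (suc zero) + ∑[ i < 2 + l ] t (suc (suc i)))
      ≡⟨ cong₂ (λ x y → x + (y + ∑[ i < 2 + l ] t (suc (suc i))))
           (#treesWithRoot-childless A A-childless₁ k)
           (#treesWithRoot-childless A A-childless₂ k) ⟩
    ∑[ i < 2 + l ] t (suc (suc i))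
      -- Row m is split off, as the only row with two allowed colors.
      ≡⟨ sum-init-last (λ i → t (suc (suc i))) ⟩
    ∑[ i < 1 + l ] t (suc (suc (inject₁ i))) + t (suc (suc (fromℕ (1 + l))))
      ≡⟨ cong₂ _+_
           (sum-one (1 + l) (λ i → t (suc (suc (inject₁ i)))) λ i →
             #treesWithRoot-onlyLeaf A {suc (suc (inject₁ i))} (A-middle i) A-childless₂ (1 + k))
           (#treesWithRoot-leaves A A-last-leaves (finite 2 A-last) (1 + k)) ⟩
    1 + l + 2 ^ (1 + k)
      ≡⟨ +-comm (1 + l) _ ⟩
    2 ^ (1 + k) + (1 + l) ∎
    where
    open ≡-Reasoning
    t : Fin (4 + l) → ℕ
    t i = #treesWithRoot A i (2 + k)

  -- The rows of B and its tree counts.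

  B-childless : Childless B zero
  B-childless (_ , ())

  B-row₂ : OnlyChild B (suc zero) (suc (suc (suc (fromℕ l))))
  B-row₂ rewrite fromℕ-≡ᵇ l = refl , unique
    where
    unique : ∀ j → entry B (suc zero) j ≡ 1 → j ≡ suc (suc (suc (fromℕ l)))
    unique zero ()
    unique (suc zero) ()
    unique (suc (suc zero)) ()
    -- After three successors are cancelled, the test for column m is this comparison.
    unique (suc (suc (suc j))) e with toℕ j ≡ᵇ l in eq
    ... | true = cong (λ j → suc (suc (suc j))) (≡ᵇ-fromℕ j eq)
    unique (suc (suc (suc j))) () | false

  -- The entries of rows 2 and 3 compute to the same Booleans.
  B-row₃ : OnlyChild B (suc (suc zero)) (suc (suc (suc (fromℕ l))))
  B-row₃ = B-row₂

  B-row≥₄ : ∀ i → OnlyChild B (suc (suc (suc i))) zero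
  B-row≥₄ i = refl , λ { zero _ → refl ; (suc _) () }

  module _ (k : ℕ) where

    #treesWithRoot-B₂ : #treesWithRoot B (suc zero) (2 + k) ≡ 2 ^ k
    -- The path of colors is 2, m, 1: row m is among the rows from 4 on because m is at least 4.
    #treesWithRoot-B₂ = #treesWithRoot-path B B-row₂ (B-row≥₄ (fromℕ l)) B-childless k

    #treesWithRoot-B₃ : #treesWithRoot B (suc (suc zero)) (2 + k) ≡ 2 ^ k
    #treesWithRoot-B₃ = #treesWithRoot-path B B-row₃ (B-row≥₄ (fromℕ l)) B-childless k

    #treesWithRoot-B≥₄ : ∀ i → #treesWithRoot B (suc (suc (suc i))) (2 + k) ≡ 1
    #treesWithRoot-B≥₄ i = #treesWithRoot-onlyLeaf B (B-row≥₄ i) B-childless (1 + k)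

    #trees-B : #trees B (2 + k) ≡ 2 ^ (1 + k) + (1 + l)
    #trees-B = begin
      #trees B (2 + k)
        ≡⟨ #trees-sum B (2 + k) ⟩
      t zero + (t (suc zero) + (t (suc (suc zero)) + ∑[ i < 1 + l ] t (suc (suc (suc i)))))
        ≡⟨ cong₂ _+_ (#treesWithRoot-childless B B-childless k)
             (cong₂ _+_ #treesWithRoot-B₂
               (cong₂ _+_ #treesWithRoot-B₃ (sum-one (1 + l) (λ i → t (suc (suc (suc i)))) #treesWithRoot-B≥₄))) ⟩
      2 ^ k + (2 ^ k + (1 + l))
        ≡⟨ +-assoc (2 ^ k) (2 ^ k) (1 + l) ⟨
      2 ^ k + 2 ^ k + (1 + l)
        ≡⟨ cong (λ x → 2 ^ k + x + (1 + l)) (+-identityʳ (2 ^ k)) ⟨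
      2 ^ (1 + k) + (1 + l) ∎
      where
      open ≡-Reasoning
      t : Fin (4 + l) → ℕ
      t i = #treesWithRoot B i (2 + k)

  -- Failure of strong equivalence at two vertices.

  -- At size two every other color has count `2 ^ 0` or 1, hence nonzero.
  B-zero : ∀ i → #treesWithRoot B i 2 ≡ 0 → i ≡ zero
  B-zero zero                _   = refl
  B-zero (suc zero)          t≡0 = ⊥-elim (1+n≢0 (trans (sym (#treesWithRoot-B₂ 0)) t≡0))
  B-zero (suc (suc zero))    t≡0 = ⊥-elim (1+n≢0 (trans (sym (#treesWithRoot-B₃ 0)) t≡0))
  B-zero (suc (suc (suc i))) t≡0 = ⊥-elim (1+n≢0 (trans (sym (#treesWithRoot-B≥₄ 0 i)) t≡0))

  -- Conjugation only renames colors, so a child in the conjugate pulls back along the inverse of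
  -- `π` to a child of `i` in A.
  conjugate-childless : ∀ π i → Childless A i → Childless (conjugate π A) (π ⟨$⟩ʳ i)
  conjugate-childless π i ¬c (j , e) = ¬c (π ⟨$⟩ˡ j , (begin
    entry A i (π ⟨$⟩ˡ j)                       ≡⟨ cong (λ i → entry A i (π ⟨$⟩ˡ j)) (inverseˡ π) ⟨
    entry A (π ⟨$⟩ˡ (π ⟨$⟩ʳ i)) (π ⟨$⟩ˡ j)     ≡⟨ conjugate-entry π (entry A) (π ⟨$⟩ʳ i) j ⟨
    entry (conjugate π A) (π ⟨$⟩ʳ i) j         ≡⟨ e ⟩
    1 ∎))
    where open ≡-Reasoning

  -- Equal counts would force `π` to send both childless colors of A to color 1 of B, against
  -- injectivity.
  ¬equivalent-two : ∀ π → ¬ (∀ i → #treesWithRoot (conjugate π A) i 2 ≡ #treesWithRoot B i 2)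
  ¬equivalent-two π equivalent = 0≢1+n (begin
      zero                     ≡⟨ inverseˡ π ⟨
      π ⟨$⟩ˡ (π ⟨$⟩ʳ zero)     ≡⟨ cong (π ⟨$⟩ˡ_) (trans (image A-childless₁) (sym (image A-childless₂))) ⟩
      π ⟨$⟩ˡ (π ⟨$⟩ʳ suc zero) ≡⟨ inverseˡ π ⟩
      suc zero ∎)
    where
    open ≡-Reasoning
    image : ∀ {i} → Childless A i → π ⟨$⟩ʳ i ≡ zero
    image {i} ¬c = B-zero (π ⟨$⟩ʳ i) (trans
      (sym (equivalent (π ⟨$⟩ʳ i)))
      (#treesWithRoot-childless (conjugate π A) (conjugate-childless π i ¬c) 0))

-- Passage to arbitrary m and n.

#trees-AB : ∀ m → 4 ≤ m → ∀ n → 2 ≤ n →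
            (#trees (matrixA m) n ≡ 2 ^ (n ∸ 1) + (m ∸ 3)) × (#trees (matrixB m) n ≡ 2 ^ (n ∸ 1) + (m ∸ 3))
-- Matching on the bounds gives m = 4 + l and n = 2 + k, so both truncated subtractions compute.
#trees-AB _ (s≤s (s≤s (s≤s (s≤s {n = l} _)))) _ (s≤s (s≤s {n = k} _)) = #trees-A l k , #trees-B l k

#treesWithRoot-A≁B : ∀ m → 4 ≤ m → ∀ π →
                     ¬ (∀ i → #treesWithRoot (conjugate π (matrixA m)) i 2 ≡ #treesWithRoot (matrixB m) i 2)
#treesWithRoot-A≁B _ (s≤s (s≤s (s≤s (s≤s {n = l} _)))) = ¬equivalent-two l

theorem37 : (m : ℕ) → 4 ≤ m →
    ((n : ℕ) → 2 ≤ n →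
    (treeCount (matrixA m) n ≡ 2 ^ (n ∸ 1) + (m ∸ 3)) ×
    (treeCount (matrixB m) n ≡ 2 ^ (n ∸ 1) + (m ∸ 3))) ×
    ((treeCount (matrixA m) 1 ≡ m) × (treeCount (matrixB m) 1 ≡ m)) ×
    (¬ StronglyTreeColoringEquivalent (matrixA m) (matrixB m))
theorem37 m 4≤m =
  (λ n 2≤n → trans (treeCount≡#trees (matrixA m) n) (proj₁ (#trees-AB m 4≤m n 2≤n)) ,
             trans (treeCount≡#trees (matrixB m) n) (proj₂ (#trees-AB m 4≤m n 2≤n))) ,
  (trans (treeCount≡#trees (matrixA m) 1) (#trees-one (matrixA m)) ,
   trans (treeCount≡#trees (matrixB m) 1) (#trees-one (matrixB m))) ,
  λ (π , equivalent) → #treesWithRoot-A≁B m 4≤m π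
    (#treesWithRoot-equivalent {A = conjugate π (matrixA m)} {matrixB m} equivalent 2 (s≤s z≤n))
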